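{- Let RDTSR be run with thresholds $\lambda_s = C_s$ and $\lambda_c = C_c$. Then its competitive ratio is at most $$3 - \frac{1}{C_s} - \frac{1}{C_c}\Bigl(2 - \frac{1}{C_s}\Bigr),$$ i.e., for every demand sequence $\mathbf{D}$, $$\mathcal{C}(\mathbf{D},\mathrm{RDTSR}) \le \Bigl(3 - \frac{1}{C_s} - \frac{1}{C_c}\Bigl(2 - \frac{1}{C_s}\Bigr)\Bigr)\cdot \mathit{OPT}(\mathbf{D}).$$
   Context: **Problem (two-level ski-rental).** There are $K$ items, an integer single purchase price $C_s>1$ and an integer combo purchase price $C_c$ with $C_s < C_c < K C_s$. Time is slotted, $t=1,\dots,T$, where the finite horizon $T$ is arbitrary and unknown to the online algorithm. A demand sequence is $\mathbf{D}=\{d(t)\}_{t=1}^T$ with $d(t)=(i(t),a(t))$, where $i(t)\in\{1,\dots,K\}$ is an item and $a(t)$ is a non-negative integer (amount of demand for that item); $d(t)=(0,0)$ means that there is no demand in slot $t$ (no action is then required or taken). A solution consists of rental decisions $r(t)\in\{0,1\}$, single purchase times $t_k \in\{1,2,\dots\}\cup\{\infty\}$ for $k=1,\dots,K$ ($\infty$ if never made), and a combo purchase time $t_c\in\{1,2,\dots\}\cup\{\infty\}$. It is feasible if in every slot $t$ with a demand, $r(t)+\mathbf{1}_{\{t\ge t_{i(t)}\}}+\mathbf{1}_{\{t\ge t_c\}}\ge 1$. Its cost is $\sum_{t=1}^T a(t)r(t)+\sum_{k=1}^K C_s\mathbf{1}_{\{t_k\le T\}}+C_c\mathbf{1}_{\{t_c\le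 T\}}$. $\mathcal{C}(\mathbf{D},\pi)$ is the cost of algorithm $\pi$ on $\mathbf{D}$, and $\mathit{OPT}(\mathbf{D})$ is the minimum cost of a feasible solution for $\mathbf{D}$ (with full knowledge of $\mathbf{D}$). The competitive ratio (CR) of an online algorithm $\pi$ is at most $c$ if $\mathcal{C}(\mathbf{D},\pi)\le c\cdot\mathit{OPT}(\mathbf{D})$ for every $\mathbf{D}$. **Algorithm RDTSR** with integer thresholds $\lambda_s\in(1,C_s]$ and $\lambda_c\in(1,C_c]$. Initially $\psi_k(0)=0$, $t_k=\infty$ for all $k$, $t_c=\infty$, and $r(t)=0$ for all $t$. When a demand $d(t)=(i(t),a(t))$ arrives in slot $t$: 1. Update the indicative costs: $\psi_k(t)=\psi_k(t-1)+a(t)$ if $k=i(t)$ and the demand is not covered by an earlier purchase (i.e. neither a single purchase of item $k$ nor a combo purchase has been made before slot $t$); otherwise $\psi_k(t)=\psi_k(t-1)$. Set $\psi_c(t)=\sum_{k=1}^K\min\{\psi_k(t),\lambda_s\}$. 2. If the demand is covered by an earlier single purchase of item $i(t)$ or by an earlier combo purchase, do nothing. 3. Otherwise: if $\psi_c(t)\ge\lambda_c$, make the combo purchase ($t_c=t$); else if $\psi_{i(t)}(t)\ge\lambda_s$, make the single purchase of item $i(t)$ ($t_{i(t)}=t$); else rent ($r(t)=1$). -}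

module Defs where

open import Data.Bool as Bool using (Bool; true; false; if_then_else_; _∨_)
open import Data.Empty using (⊥-elim)
open import Data.Fin using (Fin; zero; suc; toℕ; fromℕ<; finToFun; funToFin)
open import Data.Fin.Properties using (all?; finToFun-funToFin; toℕ-fromℕ<; toℕ<n)
open import Data.Integer using (+_)
open import Data.List using (List; map; filter; allFin; cartesianProduct)
open import Data.List.Extrema.Nat using (argmin; argmin-all; f[argmin]≤f[xs])
import Data.List.Relation.Unary.All as List
open import Data.List.Relation.Unary.All.Properties using (all-filter)
open import Data.List.Membership.Propositional using (_∈_)
open import Data.List.Membership.Propositional.Properties
  using (∈-map⁺; ∈-filter⁺; ∈-cartesianProduct⁺; ∈-allFin)
open import Data.Maybe using (Maybe; just; nothing)
import Data.Maybe.Relation.Unary.All as Maybe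
open import Data.Nat using (ℕ; zero; suc; _+_; _*_; _≤_; _<_; _≤ᵇ_; _<ᵇ_; _⊓_; z≤n; s≤s; NonZero)
open import Data.Nat.Properties
  using (+-0-monoid; ≤-refl; ≤-trans; <ᵇ⇒<; _≤?_; _<?_)
open import Data.Product using (∃; _×_; _,_; proj₁; proj₂)
open import Data.Rational as ℚ using (ℚ)
open import Data.Vec.Functional using (Vector; _∷_; updateAt)
open import Function using (_∘_; const)
open import Relation.Binary.PropositionalEquality
  using (_≡_; refl; sym; trans; cong; cong₂; subst)
open import Relation.Nullary using (Dec; yes; no)
open import Algebra.Properties.Monoid.Sum +-0-monoid using (sum-syntax; sum-cong-≗)

----------------------------------------------------------------------
-- The two-level ski-rental problem

-- `just (i , a)` is the demand d(t) = (i, a); `nothing` is d(t) = (0, 0).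
Demand : ℕ → Set
Demand K = Maybe (Fin K × ℕ)

-- Position j : Fin T holds the demand of slot t = slot j ∈ {1, …, T}.
Demands : ℕ → ℕ → Set
Demands K T = Vector (Demand K) T

slot : ∀ {T} → Fin T → ℕ
slot j = suc (toℕ j)

amount : ∀ {K} → Demand K → ℕ
amount nothing        = 0
amount (just (i , a)) = a

-- Elements of {1, 2, …} ∪ {∞}.
data PurchaseTime : Set where
  at : (t : ℕ) .{{_ : NonZero t}} → PurchaseTime
  ∞  : PurchaseTime

_≤ᵗ_ : PurchaseTime → ℕ → Bool
at s ≤ᵗ t = s ≤ᵇ t
∞    ≤ᵗ t = false

𝟙 : Bool → ℕ
𝟙 true  = 1
𝟙 false = 0

record Solution (K T : ℕ) : Set where
  constructor solution
  field
    rent   : Vector Bool T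
    single : Vector PurchaseTime K
    combo  : PurchaseTime

open Solution public

Feasible : ∀ {K T} → Demands K T → Solution K T → Set
Feasible D σ = ∀ j → Maybe.All
  (λ (i , a) → 1 ≤ 𝟙 (rent σ j) + 𝟙 (single σ i ≤ᵗ slot j) + 𝟙 (combo σ ≤ᵗ slot j))
  (D j)

cost : (Cs Cc : ℕ) → ∀ {K T} → Demands K T → Solution K T → ℕ
cost Cs Cc {K} {T} D σ =
    (∑[ j < T ] (amount (D j) * 𝟙 (rent σ j)))
  + (∑[ k < K ] (Cs * 𝟙 (single σ k ≤ᵗ T)))
  + Cc * 𝟙 (combo σ ≤ᵗ T)

----------------------------------------------------------------------
-- The offline optimum

Optimal : (Cs Cc : ℕ) → ∀ {K T} → Demands K T → Solution K T → Set
Optimal Cs Cc D σ =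
  Feasible D σ × (∀ τ → Feasible D τ → cost Cs Cc D σ ≤ cost Cs Cc D τ)

-- The minimum exists: a purchase after the horizon may be replaced by no
-- purchase, and this leaves finitely many solutions to compare.
private

  feasible? : ∀ {K T} (D : Demands K T) σ → Dec (Feasible D σ)
  feasible? D σ = all? (λ j → Maybe.dec (λ _ → _ ≤? _) (D j))

  rentAlways : ∀ {K T} → Solution K T
  rentAlways = solution (const true) (const ∞) ∞

  rentAlways-feasible : ∀ {K T} (D : Demands K T) → Feasible D rentAlways
  rentAlways-feasible D j = Maybe.universal (λ _ → s≤s z≤n) (D j)

  toBool : Fin 2 → Bool
  toBool zero    = false
  toBool (suc _) = true

  fromBool : Bool → Fin 2
  fromBool false = zero
  fromBool true  = suc zero

  toBool-fromBool : ∀ b → toBool (fromBool b) ≡ b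
  toBool-fromBool false = refl
  toBool-fromBool true  = refl

  toTime : ∀ {T} → Fin (suc T) → PurchaseTime
  toTime zero    = ∞
  toTime (suc j) = at (slot j)

  fromTime : ∀ T → PurchaseTime → Fin (suc T)
  fromTime T ∞ = zero
  fromTime T (at (suc s)) with s <? T
  ... | yes s<T = suc (fromℕ< s<T)
  ... | no  _   = zero

  toTime-fromTime : ∀ {T} p {t} → t ≤ T → (toTime (fromTime T p) ≤ᵗ t) ≡ (p ≤ᵗ t)
  toTime-fromTime ∞ t≤T = refl
  toTime-fromTime {T} (at (suc s)) {t} t≤T with s <? T
  ... | yes s<T = cong (_<ᵇ t) (toℕ-fromℕ< s<T)
  ... | no  s≮T with s <ᵇ t in eq
  ...   | false = refl
  ...   | true  = ⊥-elim (s≮T (≤-trans (<ᵇ⇒< s t (subst Bool.T (sym eq) _)) t≤T))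

  _≈_ : ∀ {K T} → Solution K T → Solution K T → Set
  _≈_ {T = T} σ τ =
      (∀ j → rent σ j ≡ rent τ j)
    × (∀ k {t} → t ≤ T → (single σ k ≤ᵗ t) ≡ (single τ k ≤ᵗ t))
    × (∀ {t} → t ≤ T → (combo σ ≤ᵗ t) ≡ (combo τ ≤ᵗ t))

  cost-≈ : ∀ Cs Cc {K T} (D : Demands K T) σ τ → σ ≈ τ → cost Cs Cc D σ ≡ cost Cs Cc D τ
  cost-≈ Cs Cc D σ τ (r , s , c) = cong₂ _+_
    (cong₂ _+_
      (sum-cong-≗ (λ j → cong (λ b → amount (D j) * 𝟙 b) (r j)))
      (sum-cong-≗ (λ k → cong (λ b → Cs * 𝟙 b) (s k ≤-refl))))
    (cong (λ b → Cc * 𝟙 b) (c ≤-refl))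

  feasible-≈ : ∀ {K T} (D : Demands K T) σ τ → σ ≈ τ → Feasible D τ → Feasible D σ
  feasible-≈ D σ τ (r , s , c) f j = Maybe.map
    (λ {(i , a)} → subst (1 ≤_) (sym (cong₂ _+_
      (cong₂ _+_ (cong 𝟙 (r j)) (cong 𝟙 (s i (toℕ<n j))))
      (cong 𝟙 (c (toℕ<n j))))))
    (f j)

  module _ {K T : ℕ} where

    decode : Fin _ × Fin _ × Fin _ → Solution K T
    decode (r , s , c) =
      solution (toBool ∘ finToFun {2} {T} r) (toTime ∘ finToFun {suc T} {K} s) (toTime {T} c)

    candidates : List (Solution K T)
    candidates = map decode
      (cartesianProduct (allFin _) (cartesianProduct (allFin _) (allFin _)))

    candidate : ∀ σ → ∃ λ τ → τ ∈ candidates × τ ≈ σ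
    candidate σ = _
      , ∈-map⁺ decode (∈-cartesianProduct⁺
          (∈-allFin (funToFin r)) (∈-cartesianProduct⁺ (∈-allFin (funToFin s)) (∈-allFin (fromTime T (combo σ)))))
      , (λ j → trans (cong toBool (finToFun-funToFin r j)) (toBool-fromBool (rent σ j)))
      , (λ k {t} t≤T → trans (cong (λ x → toTime x ≤ᵗ t) (finToFun-funToFin s k))
                             (toTime-fromTime (single σ k) t≤T))
      , toTime-fromTime (combo σ)
      where
      r = fromBool ∘ rent σ
      s = fromTime T ∘ single σ

optimal : (Cs Cc : ℕ) → ∀ {K T} (D : Demands K T) → ∃ (Optimal Cs Cc D)
optimal Cs Cc D = best
  , argmin-all c {P = Feasible D} (rentAlways-feasible D) (all-filter (feasible? D) candidates)
  , λ τ f → let (τ′ , τ′∈ , τ′≈τ) = candidate τ in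
      subst (c best ≤_) (cost-≈ Cs Cc D τ′ τ τ′≈τ)
        (List.lookup (f[argmin]≤f[xs] {f = c} rentAlways (filter (feasible? D) candidates))
          (∈-filter⁺ (feasible? D) τ′∈ (feasible-≈ D τ′ τ τ′≈τ f)))
  where
  c = cost Cs Cc D
  best = argmin c rentAlways (filter (feasible? D) candidates)

OPT : (Cs Cc : ℕ) → ∀ {K T} → Demands K T → ℕ
OPT Cs Cc D = cost Cs Cc D (proj₁ (optimal Cs Cc D))

----------------------------------------------------------------------
-- Competitive ratio

Algorithm : ℕ → Set
Algorithm K = ∀ {T} → Demands K T → Solution K T

toℚ : ℕ → ℚ
toℚ n = + n ℚ./ 1

CompetitiveRatioAtMost : (Cs Cc : ℕ) → ∀ {K} → Algorithm K → ℚ → Set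
CompetitiveRatioAtMost Cs Cc {K} π c = ∀ {T} (D : Demands K T) →
  toℚ (cost Cs Cc D (π D)) ℚ.≤ c ℚ.* toℚ (OPT Cs Cc D)

----------------------------------------------------------------------
-- RDTSR

-- ψ holds the indicative costs ψₖ; tₛ and tc hold the purchases made so far
-- (∞ for those not made yet).
record State (K : ℕ) : Set where
  constructor state
  field
    ψ  : Vector ℕ K
    tₛ : Vector PurchaseTime K
    tc : PurchaseTime

open State public

initial : ∀ {K} → State K
initial = state (const 0) (const ∞) ∞

bought : PurchaseTime → Bool
bought (at _) = true
bought ∞      = false

module _ (λs λc : ℕ) {K : ℕ} where

  -- One slot: the new state and the rental decision r(t).
  step : (t : ℕ) .{{_ : NonZero t}} → Demand K → State K → State K × Bool
  step t nothing s = s , false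
  step t (just (i , a)) (state ψ tₛ tc) =
    if bought (tₛ i) ∨ bought tc then state ψ tₛ tc , false
    else if λc ≤ᵇ ψc then state ψ′ tₛ (at t) , false
    else if λs ≤ᵇ ψ′ i then state ψ′ (updateAt tₛ i (const (at t))) tc , false
    else state ψ′ tₛ tc , true
    where
    ψ′ = updateAt ψ i (_+ a)
    ψc = ∑[ k < K ] (ψ′ k ⊓ λs)

  -- The first demand of the sequence belongs to slot t.
  run : (t : ℕ) .{{_ : NonZero t}} → ∀ {T} → Demands K T → State K → State K × Vector Bool T
  run t {zero}  D s = s , λ ()
  run t {suc T} D s =
    let s₁ , r  = step t (D zero) s
        s₂ , rs = run (suc t) (D ∘ suc) s₁
    in  s₂ , r ∷ rs

  RDTSR : Algorithm K
  RDTSR D = let s , r = run 1 D initial in solution r (tₛ s) (tc s)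

{-# OPTIONS --safe #-}
-- Write Ψ(ψ) = ∑ₖ min(ψₖ, Cs). Let ψ° be the indicative costs just before the combo purchase, or at
-- the end if there is none. A single purchase of k has been made iff ψ°ₖ ≥ Cs, and the rent paid for k
-- is at most min(ψ°ₖ, Cs − 1), so the cost without the combo purchase is at most (2 − 1/Cs) Ψ(ψ°), where
-- Ψ(ψ°) ≤ Cc − 1. Conversely, a solution without combo purchase pays at least Ψ(ψ) for the final ψ,
-- hence OPT ≥ min(Cc, Ψ(ψ)). If RDTSR buys the combo, then Ψ(ψ) ≥ Cc, so OPT ≥ Cc and the cost is at most
-- (2 − 1/Cs)(Cc − 1) + Cc; otherwise ψ = ψ° and the ratio is at most 2 − 1/Cs.
module Submission where

open import Defs
open import Data.Bool using (Bool; true; false; if_then_else_; _∨_; T)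
open import Data.Bool.Properties using (∨-zeroʳ; T-≡)
open import Data.Fin using (Fin; zero; suc)
open import Data.Fin.Properties using (toℕ<n)
open import Data.Integer as ℤ using (+_)
import Data.Integer.Properties as ℤ
import Data.Maybe.Relation.Unary.All as Maybe
open import Data.Maybe using (just; nothing)
open import Data.Nat
  using (ℕ; zero; suc; _+_; _*_; _≤_; _<_; _≤ᵇ_; _⊓_; z≤n; s≤s; NonZero)
open import Data.Nat.Properties
open import Data.Nat.Tactic.RingSolver using (solve-∀)
open import Data.Product using (_×_; _,_; proj₁; proj₂)
open import Data.Rational as ℚ using (_/_)
import Data.Rational.Properties as ℚ
import Data.Rational.Unnormalised as ℚᵘ
import Data.Rational.Unnormalised.Properties as ℚᵘ
open import Data.Rational.Solver using (module +-*-Solver)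
open import Data.Sum using (_⊎_; inj₁; inj₂)
open import Data.Vec.Functional using (Vector; updateAt)
open import Data.Vec.Functional.Properties using (updateAt-updates)
open import Algebra.Properties.Semiring.Sum +-*-semiring
  using (sum; sum-syntax; ∑-distrib-+; *-distribˡ-sum)
open import Function using (_∘_; const; Equivalence)
open import Relation.Binary.PropositionalEquality
  using (_≡_; refl; sym; trans; cong; cong₂; subst; module ≡-Reasoning)
open import Relation.Nullary using (contradiction)

-- Sums, pointwise updates and Boolean comparisons

sum-mono-≤ : ∀ {n} {f g : Vector ℕ n} → (∀ k → f k ≤ g k) → sum f ≤ sum g
sum-mono-≤ {zero}  f≤g = z≤n
sum-mono-≤ {suc n} f≤g = +-mono-≤ (f≤g zero) (sum-mono-≤ (f≤g ∘ suc))

sum-updateAt-+ : ∀ {n} (f : Vector ℕ n) i a → sum (updateAt f i (_+ a)) ≡ sum f + a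
sum-updateAt-+ f zero    a = solve (f zero) (sum (f ∘ suc)) a
  where
  solve : ∀ x y z → x + z + y ≡ x + y + z
  solve = solve-∀
sum-updateAt-+ f (suc i) a =
  trans (cong (_+_ (f zero)) (sum-updateAt-+ (f ∘ suc) i a)) (sym (+-assoc (f zero) _ a))

-- The two vectors may differ in type and in update function. This serves both for relating ψ to the
-- purchase times and for comparing a capped vector that is then updated with an updated vector that
-- is then capped.
updateAt-pointwise : ∀ {n} {A B : Set} (P : Fin n → A → B → Set) i {f g}
  {xs : Vector A n} {ys : Vector B n} →
  P i (f (xs i)) (g (ys i)) → (∀ k → P k (xs k) (ys k)) →
  ∀ k → P k (updateAt xs i f k) (updateAt ys i g k)
updateAt-pointwise P zero    pᵢ p zero    = pᵢ
updateAt-pointwise P zero    pᵢ p (suc k) = p (suc k)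
updateAt-pointwise P (suc i) pᵢ p zero    = p zero
updateAt-pointwise P (suc i) pᵢ p (suc k) = updateAt-pointwise (P ∘ suc) i pᵢ (p ∘ suc) k

updateAt-increase : ∀ {n} (f : Vector ℕ n) i a k → f k ≤ updateAt f i (_+ a) k
updateAt-increase f zero    a zero    = m≤m+n (f zero) a
updateAt-increase f zero    a (suc k) = ≤-refl
updateAt-increase f (suc i) a zero    = ≤-refl
updateAt-increase f (suc i) a (suc k) = updateAt-increase (f ∘ suc) i a k

≤ᵇ-true⇒≤ : ∀ {m n} → (m ≤ᵇ n) ≡ true → m ≤ n
≤ᵇ-true⇒≤ {m} {n} eq = ≤ᵇ⇒≤ m n (subst T (sym eq) _)

≤⇒≤ᵇ-true : ∀ {m n} → m ≤ n → (m ≤ᵇ n) ≡ true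
≤⇒≤ᵇ-true m≤n = Equivalence.to T-≡ (≤⇒≤ᵇ m≤n)

≤ᵇ-false⇒> : ∀ {m n} → (m ≤ᵇ n) ≡ false → n < m
≤ᵇ-false⇒> eq = ≰⇒> λ m≤n → contradiction (trans (sym (≤⇒≤ᵇ-true m≤n)) eq) λ ()

≤ᵗ-mono : ∀ p {s t} → s ≤ t → (p ≤ᵗ s) ≡ true → (p ≤ᵗ t) ≡ true
≤ᵗ-mono (at u) s≤t eq = ≤⇒≤ᵇ-true {u} (≤-trans (≤ᵇ-true⇒≤ eq) s≤t)

𝟙≤1 : ∀ b → 𝟙 b ≤ 1
𝟙≤1 true  = ≤-refl
𝟙≤1 false = z≤n

𝟙-≤ᵗ≤𝟙-bought : ∀ p t → 𝟙 (p ≤ᵗ t) ≤ 𝟙 (bought p)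
𝟙-≤ᵗ≤𝟙-bought (at s) t = 𝟙≤1 (s ≤ᵇ t)
𝟙-≤ᵗ≤𝟙-bought ∞      t = z≤n

-- Slots and runs of RDTSR

rental : ∀ {K T} → Demands K T → Vector Bool T → ℕ
rental {T = T} D r = ∑[ j < T ] (amount (D j) * 𝟙 (r j))

-- The thresholds are Cs = suc m and Cc = suc n.
module _ (m n : ℕ) {K : ℕ} where

  indicative : Vector ℕ K → ℕ
  indicative ψ = ∑[ k < K ] (ψ k ⊓ suc m)

  -- The cap is Cs - 1 because a slot is rented only if the updated ψₖ is still below Cs.
  rentBound : Vector ℕ K → ℕ
  rentBound ψ = ∑[ k < K ] (ψ k ⊓ m)

  -- A view of `step`; each constructor keeps only those guards of its branch on which later
  -- arguments rely.
  data Step (t : ℕ) .{{_ : NonZero t}} (i : Fin K) (a : ℕ) (s : State K) :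
            State K × Bool → Set where
    covered : bought (tₛ s i) ∨ bought (tc s) ≡ true → Step t i a s (s , false)
    buyCombo : let ψ′ = updateAt (ψ s) i (_+ a) in
      suc n ≤ indicative ψ′ →
      Step t i a s (state ψ′ (tₛ s) (at t) , false)
    buySingle : let ψ′ = updateAt (ψ s) i (_+ a) in
      indicative ψ′ < suc n → (suc m ≤ᵇ ψ′ i) ≡ true →
      Step t i a s (state ψ′ (updateAt (tₛ s) i (const (at t))) (tc s) , false)
    rents : let ψ′ = updateAt (ψ s) i (_+ a) in
      bought (tₛ s i) ≡ false → indicative ψ′ < suc n → (suc m ≤ᵇ ψ′ i) ≡ false →
      Step t i a s (state ψ′ (tₛ s) (tc s) , true)

  step-view : ∀ t .{{_ : NonZero t}} i a s → Step t i a s (step (suc m) (suc n) t (just (i , a)) s)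
  step-view t i a s with bought (tₛ s i) in single | bought (tc s) in combo
  ... | true  | _    = covered (cong (_∨ bought (tc s)) single)
  ... | false | true = covered (trans (cong (_∨_ (bought (tₛ s i))) combo) (∨-zeroʳ _))
  ... | false | false with suc n ≤ᵇ indicative (updateAt (ψ s) i (_+ a)) in ψc
  ...   | true = buyCombo (≤ᵇ-true⇒≤ ψc)
  ...   | false with suc m ≤ᵇ updateAt (ψ s) i (_+ a) i in ψᵢ
  ...     | true  = buySingle (≤ᵇ-false⇒> ψc) ψᵢ
  ...     | false = rents single (≤ᵇ-false⇒> ψc) ψᵢ

  -- An invariant up to the combo purchase: item k is bought in the slot where ψₖ reaches Cs, and ψₖ
  -- is frozen from then on. The combo slot itself can break it, since ψᵢ may pass Cs there without
  -- a single purchase.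
  Settled : State K → Set
  Settled s = ∀ k → bought (tₛ s k) ≡ (suc m ≤ᵇ ψ s k)

  data Progress (s : State K) (d : Demand K) : State K × Bool → Set where
    continues : ∀ {s′ r} → Settled s′ → indicative (ψ s′) < suc n → tc s′ ≡ ∞ →
      rentBound (ψ s) + amount d * 𝟙 r ≤ rentBound (ψ s′) →
      Progress s d (s′ , r)
    combines : ∀ {s′} → bought (tc s′) ≡ true → tₛ s′ ≡ tₛ s → suc n ≤ indicative (ψ s′) →
      Progress s d (s′ , false)

  step-progress : ∀ t .{{_ : NonZero t}} d s → Settled s → indicative (ψ s) < suc n → tc s ≡ ∞ →
    Progress s d (step (suc m) (suc n) t d s)
  step-progress t nothing s settled Ψ< tc≡∞ =
    continues settled Ψ< tc≡∞ (≤-reflexive (+-identityʳ _))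
  step-progress t (just (i , a)) s settled Ψ< tc≡∞
    with step (suc m) (suc n) t (just (i , a)) s | step-view t i a s
  ... | _ | covered _ = continues settled Ψ< tc≡∞
    (≤-reflexive (trans (cong (_+_ (rentBound (ψ s))) (*-zeroʳ a)) (+-identityʳ _)))
  ... | _ | buyCombo ≤Ψ′ = combines refl refl ≤Ψ′
  ... | _ | buySingle Ψ′< ψ′ᵢ≥ = continues
    (updateAt-pointwise (λ _ x p → bought p ≡ (suc m ≤ᵇ x)) i
      (sym (trans (cong (suc m ≤ᵇ_) (sym (updateAt-updates i (ψ s)))) ψ′ᵢ≥))
      settled)
    Ψ′< tc≡∞
    (begin
      rentBound (ψ s) + a * 0               ≡⟨ cong (_+_ (rentBound (ψ s))) (*-zeroʳ a) ⟩
      rentBound (ψ s) + 0                   ≡⟨ +-identityʳ _ ⟩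
      rentBound (ψ s)                       ≤⟨ sum-mono-≤ (λ k → ⊓-monoˡ-≤ m (updateAt-increase (ψ s) i a k)) ⟩
      rentBound (updateAt (ψ s) i (_+ a))   ∎)
    where open ≤-Reasoning
  ... | _ | rents unbought Ψ′< ψ′ᵢ< = continues
    -- Purchase times stay fixed here, so the second vector is a dummy that the relation ignores.
    (updateAt-pointwise (λ k x _ → bought (tₛ s k) ≡ (suc m ≤ᵇ x)) i {g = _+ a} {ys = ψ s}
      (sym (trans (cong (suc m ≤ᵇ_) (sym (updateAt-updates i (ψ s)))) (trans ψ′ᵢ< (sym unbought))))
      settled)
    Ψ′< tc≡∞
    (begin
      rentBound (ψ s) + a * 1                             ≡⟨ cong (_+_ (rentBound (ψ s))) (*-identityʳ a) ⟩
      rentBound (ψ s) + a                                 ≡⟨ sum-updateAt-+ (λ k → ψ s k ⊓ m) i a ⟨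
      sum (updateAt (λ k → ψ s k ⊓ m) i (_+ a))
        ≤⟨ sum-mono-≤ (updateAt-pointwise (λ _ x y → x ≤ y ⊓ m) i increase (λ _ → ≤-refl)) ⟩
      rentBound (updateAt (ψ s) i (_+ a))                 ∎)
    where
    open ≤-Reasoning
    -- In a rented slot the cap m is not exceeded even after the update, so `rentBound` grows by at
    -- least the full amount a.
    ψᵢ+a≤m : ψ s i + a ≤ m
    ψᵢ+a≤m = ≤-pred (subst (_< suc m) (updateAt-updates i (ψ s)) (≤ᵇ-false⇒> ψ′ᵢ<))
    increase : (ψ s i ⊓ m) + a ≤ (ψ s i + a) ⊓ m
    increase = ≤-trans (+-monoˡ-≤ a (m⊓n≤m (ψ s i) m)) (≤-reflexive (sym (m≤n⇒m⊓n≡m ψᵢ+a≤m)))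

  step-combined : ∀ t .{{_ : NonZero t}} (d : Demand K) s → bought (tc s) ≡ true →
    step (suc m) (suc n) t d s ≡ (s , false)
  step-combined t nothing s b = refl
  step-combined t (just (i , a)) s b rewrite b | ∨-zeroʳ (bought (tₛ s i)) = refl

  run-combined : ∀ t .{{_ : NonZero t}} {T} (D : Demands K T) s → bought (tc s) ≡ true →
    let s′ , r = run (suc m) (suc n) t D s in s′ ≡ s × rental D r ≡ 0
  run-combined t {zero}  D s b = refl , refl
  run-combined t {suc T} D s b =
    let stays = step-combined t (D zero) s b
        s′≡s₁ , rental≡0 = run-combined (suc t) (D ∘ suc) _
          (trans (cong (bought ∘ tc ∘ proj₁) stays) b)
    in  trans s′≡s₁ (cong proj₁ stays)
      , cong₂ _+_
          (trans (cong (λ p → amount (D zero) * 𝟙 (proj₂ p)) stays) (*-zeroʳ (amount (D zero))))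
          rental≡0

  -- `ψ°` goes with the final single purchase times because no single purchase happens in the combo
  -- slot or later. After a combo purchase, `ψ s′` includes the triggering demand and `ψ°` does not:
  -- the former yields Ψ ≥ Cc for the lower bound on OPT, the latter Ψ ≤ Cc - 1 for the upper bound
  -- on the cost.
  record Outcome (s s′ : State K) (rent : ℕ) : Set where
    field
      ψ°      : Vector ℕ K
      settled : Settled (state ψ° (tₛ s′) (tc s′))
      bounded : indicative ψ° < suc n
      rented  : rentBound (ψ s) + rent ≤ rentBound ψ°
      final   : (tc s′ ≡ ∞ × ψ s′ ≡ ψ°) ⊎ suc n ≤ indicative (ψ s′)

  run-outcome : ∀ t .{{_ : NonZero t}} {T} (D : Demands K T) s →
    Settled s → indicative (ψ s) < suc n → tc s ≡ ∞ →
    let s′ , r = run (suc m) (suc n) t D s in Outcome s s′ (rental D r)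
  run-outcome t {zero} D s settled Ψ< tc≡∞ = record
    { ψ° = ψ s ; settled = settled ; bounded = Ψ<
    ; rented = ≤-reflexive (+-identityʳ _) ; final = inj₁ (tc≡∞ , refl) }
  run-outcome t {suc T} D s settled Ψ< tc≡∞ =
    outcome (step-progress t (D zero) s settled Ψ< tc≡∞)
    where
    -- Generalised over the result p of the first slot, so that matching on `Progress` determines
    -- it.
    outcome : ∀ {p} → Progress s (D zero) p →
      let s′ , rs = run (suc m) (suc n) (suc t) (D ∘ suc) (proj₁ p) in
      Outcome s s′ (amount (D zero) * 𝟙 (proj₂ p) + rental (D ∘ suc) rs)
    outcome (continues settled₁ Ψ₁< tc₁≡∞ rent₁) = record
      { Outcome rest
      ; rented = ≤-trans (≤-reflexive (sym (+-assoc (rentBound (ψ s)) _ _)))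
                   (≤-trans (+-monoˡ-≤ _ rent₁) (Outcome.rented rest)) }
      where rest = run-outcome (suc t) (D ∘ suc) _ settled₁ Ψ₁< tc₁≡∞
    outcome (combines {s₁} combined tₛ₁≡tₛ ≤Ψ₁) =
      let s′≡s₁ , rental≡0 = run-combined (suc t) (D ∘ suc) s₁ combined in record
      { ψ° = ψ s
      ; settled = λ k → trans
          (cong (λ v → bought (v k)) (trans (cong tₛ s′≡s₁) tₛ₁≡tₛ)) (settled k)
      ; bounded = Ψ<
      ; rented = ≤-reflexive (trans
          (cong (_+_ (rentBound (ψ s))) (cong₂ _+_ (*-zeroʳ (amount (D zero))) rental≡0))
          (+-identityʳ _))
      ; final = inj₂ (subst (λ s′ → suc n ≤ indicative (ψ s′)) (sym s′≡s₁) ≤Ψ₁) }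

  -- Lower bound on the cost of any solution

  step-ψ≤ : ∀ t .{{_ : NonZero t}} i a s k →
    ψ (proj₁ (step (suc m) (suc n) t (just (i , a)) s)) k ≤ updateAt (ψ s) i (_+ a) k
  step-ψ≤ t i a s k with step (suc m) (suc n) t (just (i , a)) s | step-view t i a s
  ... | _ | covered _     = updateAt-increase (ψ s) i a k
  ... | _ | buyCombo _    = ≤-refl
  ... | _ | buySingle _ _ = ≤-refl
  ... | _ | rents _ _ _   = ≤-refl

  module _ (x : Vector Bool K) where

    -- A potential for comparison with a solution without combo purchase: `x` marks the items it
    -- buys, charged at full price from the start. Demands for any other item must all be rented, so
    -- the growth of ψₖ is paid for by rent.
    charge : Vector ℕ K → ℕ
    charge ψ = ∑[ k < K ] (if x k then suc m else ψ k)

    step-charge : ∀ t .{{_ : NonZero t}} d s r → Maybe.All (λ (i , a) → 1 ≤ 𝟙 r + 𝟙 (x i)) d →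
      charge (ψ (proj₁ (step (suc m) (suc n) t d s))) ≤ charge (ψ s) + amount d * 𝟙 r
    step-charge t nothing s r _ = ≤-reflexive (sym (+-identityʳ _))
    step-charge t (just (i , a)) s r (Maybe.just served) = begin
      charge (ψ (proj₁ (step (suc m) (suc n) t (just (i , a)) s)))
        ≤⟨ sum-mono-≤ (λ k → if-mono (x k) (step-ψ≤ t i a s k)) ⟩
      charge (updateAt (ψ s) i (_+ a))
        ≤⟨ sum-mono-≤ (updateAt-pointwise (λ k v w → (if x k then suc m else v) ≤ w) i
             (increase (x i) r served) (λ _ → ≤-refl)) ⟩
      sum (updateAt (λ k → if x k then suc m else ψ s k) i (_+ a * 𝟙 r))
        ≡⟨ sum-updateAt-+ _ i (a * 𝟙 r) ⟩
      charge (ψ s) + a * 𝟙 r ∎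
      where
      open ≤-Reasoning
      if-mono : ∀ b {v w} → v ≤ w → (if b then suc m else v) ≤ (if b then suc m else w)
      if-mono true  _   = ≤-refl
      if-mono false v≤w = v≤w
      increase : ∀ b r → 1 ≤ 𝟙 r + 𝟙 b → ∀ {v} →
        (if b then suc m else (v + a)) ≤ (if b then suc m else v) + a * 𝟙 r
      increase true  r     _ = m≤m+n (suc m) _
      -- An unmarked item without rent would contradict 1 ≤ 0, so this is the only case in which the
      -- charge grows.
      increase false true  _ {v} = ≤-reflexive (cong (_+_ v) (sym (*-identityʳ a)))

    run-charge : ∀ t .{{_ : NonZero t}} {T} (D : Demands K T) s r →
      (∀ j → Maybe.All (λ (i , a) → 1 ≤ 𝟙 (r j) + 𝟙 (x i)) (D j)) →
      charge (ψ (proj₁ (run (suc m) (suc n) t D s))) ≤ charge (ψ s) + rental D r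
    run-charge t {zero}  D s r served = ≤-reflexive (sym (+-identityʳ _))
    run-charge t {suc T} D s r served = begin
      charge (ψ (proj₁ (run (suc m) (suc n) (suc t) (D ∘ suc) s₁)))
        ≤⟨ run-charge (suc t) (D ∘ suc) s₁ (r ∘ suc) (served ∘ suc) ⟩
      charge (ψ s₁) + rental (D ∘ suc) (r ∘ suc)
        ≤⟨ +-monoˡ-≤ _ (step-charge t (D zero) s (r zero) (served zero)) ⟩
      charge (ψ s) + amount (D zero) * 𝟙 (r zero) + rental (D ∘ suc) (r ∘ suc)
        ≡⟨ +-assoc (charge (ψ s)) _ _ ⟩
      charge (ψ s) + rental D r ∎
      where
      open ≤-Reasoning
      s₁ = proj₁ (step (suc m) (suc n) t (D zero) s)

  indicative≤charge : ∀ x ψ → indicative ψ ≤ charge x ψ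
  indicative≤charge x ψ = sum-mono-≤ (λ k → bound (x k) (ψ k))
    where
    bound : ∀ b v → v ⊓ suc m ≤ (if b then suc m else v)
    bound true  v = m⊓n≤n v (suc m)
    bound false v = m⊓n≤m v (suc m)

  -- ψ may come from the run of RDTSR: it never exceeds the total demand.
  feasible-cost : ∀ {T} (D : Demands K T) σ → Feasible D σ →
    suc n ⊓ indicative (ψ (proj₁ (run (suc m) (suc n) 1 D initial))) ≤ cost (suc m) (suc n) D σ
  feasible-cost {T} D σ feasible with combo σ ≤ᵗ T in comboBy
  ... | true  = ≤-trans (m⊓n≤m (suc n) _)
                  (≤-trans (≤-reflexive (sym (*-identityʳ (suc n)))) (m≤n+m (suc n * 1) _))
  ... | false = begin
    suc n ⊓ indicative ψₑ                       ≤⟨ m⊓n≤n (suc n) _ ⟩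
    indicative ψₑ                               ≤⟨ indicative≤charge x ψₑ ⟩
    charge x ψₑ
      ≤⟨ run-charge x 1 D initial (rent σ)
           (λ j → Maybe.map (λ {(i , a)} → served j i) (feasible j)) ⟩
    charge x (const 0) + rental D (rent σ)      ≤⟨ +-monoˡ-≤ _ (sum-mono-≤ (λ k → purchase (x k))) ⟩
    ∑[ k < K ] (suc m * 𝟙 (x k)) + rental D (rent σ)  ≡⟨ +-comm _ (rental D (rent σ)) ⟩
    rental D (rent σ) + ∑[ k < K ] (suc m * 𝟙 (x k))  ≤⟨ m≤m+n _ _ ⟩
    rental D (rent σ) + ∑[ k < K ] (suc m * 𝟙 (x k)) + suc n * 0  ∎
    where
    open ≤-Reasoning
    x : Vector Bool K
    -- Purchases up to the horizon count as if made at the start; this only enlarges the set of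
    -- covered demands.
    x k = single σ k ≤ᵗ T
    ψₑ = ψ (proj₁ (run (suc m) (suc n) 1 D initial))
    purchase : ∀ b → (if b then suc m else 0) ≤ suc m * 𝟙 b
    purchase true  = ≤-reflexive (sym (*-identityʳ (suc m)))
    purchase false = z≤n
    𝟙-mono : ∀ p {s} → s ≤ T → 𝟙 (p ≤ᵗ s) ≤ 𝟙 (p ≤ᵗ T)
    𝟙-mono p {s} s≤T with p ≤ᵗ s in eq
    ... | false = z≤n
    ... | true  = ≤-reflexive (cong 𝟙 (sym (≤ᵗ-mono p s≤T eq)))
    served : ∀ j i →
      1 ≤ 𝟙 (rent σ j) + 𝟙 (single σ i ≤ᵗ slot j) + 𝟙 (combo σ ≤ᵗ slot j) →
      1 ≤ 𝟙 (rent σ j) + 𝟙 (x i)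
    served j i 1≤ = begin
      1 ≤⟨ 1≤ ⟩
      𝟙 (rent σ j) + 𝟙 (single σ i ≤ᵗ slot j) + 𝟙 (combo σ ≤ᵗ slot j)
        ≤⟨ +-mono-≤ (+-monoʳ-≤ (𝟙 (rent σ j)) (𝟙-mono (single σ i) (toℕ<n j))) (𝟙-mono (combo σ) (toℕ<n j)) ⟩
      -- No combo purchase by T means none in any slot, so rent or a single purchase has to serve
      -- the demand.
      𝟙 (rent σ j) + 𝟙 (x i) + 𝟙 (combo σ ≤ᵗ T)   ≡⟨ cong (λ b → 𝟙 (rent σ j) + 𝟙 (x i) + 𝟙 b) comboBy ⟩
      𝟙 (rent σ j) + 𝟙 (x i) + 0                  ≡⟨ +-identityʳ _ ⟩
      𝟙 (rent σ j) + 𝟙 (x i)                      ∎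

  -- Upper bound on the cost of RDTSR and the ratio in integers

  purchaseBound : Vector ℕ K → ℕ
  purchaseBound ψ = ∑[ k < K ] (suc m * 𝟙 (suc m ≤ᵇ ψ k))

  -- Item by item: if ψₖ ≥ Cs, at most Cs - 1 of rent plus the price Cs stand against Cs, which is
  -- the factor (2 Cs - 1)/Cs; otherwise only rent is paid, with factor 1. Multiplying by `suc m`
  -- clears the denominator.
  rent+purchase≤ : ∀ ψ →
    suc m * (rentBound ψ + purchaseBound ψ) ≤ (1 + 2 * m) * indicative ψ
  rent+purchase≤ ψ = begin
    suc m * (rentBound ψ + purchaseBound ψ)
      ≡⟨ cong (_*_ (suc m)) (∑-distrib-+ (λ k → ψ k ⊓ m) (λ k → suc m * 𝟙 (suc m ≤ᵇ ψ k))) ⟨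
    suc m * ∑[ k < K ] (ψ k ⊓ m + suc m * 𝟙 (suc m ≤ᵇ ψ k))
      ≡⟨ *-distribˡ-sum {K} (suc m) _ ⟩
    ∑[ k < K ] (suc m * (ψ k ⊓ m + suc m * 𝟙 (suc m ≤ᵇ ψ k)))
      ≤⟨ sum-mono-≤ (λ k → item (ψ k)) ⟩
    ∑[ k < K ] ((1 + 2 * m) * (ψ k ⊓ suc m))
      ≡⟨ *-distribˡ-sum {K} (1 + 2 * m) _ ⟨
    (1 + 2 * m) * indicative ψ ∎
    where
    open ≤-Reasoning
    full : ∀ m → suc m * (m + suc m * 1) ≡ (1 + 2 * m) * suc m
    full = solve-∀
    item : ∀ v → suc m * (v ⊓ m + suc m * 𝟙 (suc m ≤ᵇ v)) ≤ (1 + 2 * m) * (v ⊓ suc m)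
    item v with suc m ≤ᵇ v in eq
    ... | true  = begin
      suc m * (v ⊓ m + suc m * 1)   ≤⟨ *-monoʳ-≤ (suc m) (+-monoˡ-≤ _ (m⊓n≤n v m)) ⟩
      suc m * (m + suc m * 1)       ≡⟨ full m ⟩
      (1 + 2 * m) * suc m           ≡⟨ cong (_*_ (1 + 2 * m)) (m≥n⇒m⊓n≡n (≤ᵇ-true⇒≤ {suc m} eq)) ⟨
      (1 + 2 * m) * (v ⊓ suc m)     ∎
    ... | false = begin
      suc m * (v ⊓ m + suc m * 0)   ≡⟨ cong (λ z → suc m * (v ⊓ m + z)) (*-zeroʳ (suc m)) ⟩
      suc m * (v ⊓ m + 0)           ≡⟨ cong (_*_ (suc m)) (+-identityʳ (v ⊓ m)) ⟩
      suc m * (v ⊓ m)               ≤⟨ *-mono-≤ (s≤s (m≤m+n m _)) (⊓-monoʳ-≤ v (n≤1+n m)) ⟩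
      (1 + 2 * m) * (v ⊓ suc m)     ∎

  -- The ratio multiplied by Cs Cc, against an arbitrary feasible solution. The two cases of `final`
  -- are combined with `lower` and `upper`.
  RDTSR-ratio : 1 ≤ n → ∀ {T} (D : Demands K T) σ → Feasible D σ →
    suc m * suc n * cost (suc m) (suc n) D (RDTSR (suc m) (suc n) D)
      ≤ (suc m * suc n + (1 + 2 * m) * n) * cost (suc m) (suc n) D σ
  RDTSR-ratio 1≤n {T} D σ feasible = bound final
    where
    open ≤-Reasoning
    sₑ = proj₁ (run (suc m) (suc n) 1 D initial)
    rs = proj₂ (run (suc m) (suc n) 1 D initial)
    initially : indicative (const 0) < suc n
    initially = s≤s (≤-trans (≤-reflexive (sum-zero K)) z≤n)
      where
      sum-zero : ∀ K → ∑[ k < K ] 0 ≡ 0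
      sum-zero zero    = refl
      sum-zero (suc K) = sum-zero K
    open Outcome (run-outcome 1 D initial (λ _ → refl) initially refl)
    opt = cost (suc m) (suc n) D σ
    lower : suc n ⊓ indicative (ψ sₑ) ≤ opt
    lower = feasible-cost D σ feasible
    rent+singles = rental D rs + ∑[ k < K ] (suc m * 𝟙 (tₛ sₑ k ≤ᵗ T))
    upper : suc m * rent+singles ≤ (1 + 2 * m) * indicative ψ°
    upper = begin
      suc m * rent+singles
        -- Every purchase ever recorded is counted, whether or not its time is compared with T;
        -- `settled` then expresses this through `ψ°`.
        ≤⟨ *-monoʳ-≤ (suc m) (+-mono-≤ (≤-trans (m≤n+m _ _) rented)
             (sum-mono-≤ (λ k → *-monoʳ-≤ (suc m) (≤-trans
               (𝟙-≤ᵗ≤𝟙-bought (tₛ sₑ k) T) (≤-reflexive (cong 𝟙 (settled k))))))) ⟩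
      suc m * (rentBound ψ° + purchaseBound ψ°) ≤⟨ rent+purchase≤ ψ° ⟩
      (1 + 2 * m) * indicative ψ° ∎
    bound : _ → suc m * suc n * cost (suc m) (suc n) D (RDTSR (suc m) (suc n) D)
      ≤ (suc m * suc n + (1 + 2 * m) * n) * opt
    bound (inj₁ (tc≡∞ , ψ≡ψ°)) = begin
      suc m * suc n * (rent+singles + suc n * 𝟙 (tc sₑ ≤ᵗ T))
        ≡⟨ cong (λ p → suc m * suc n * (rent+singles + suc n * 𝟙 (p ≤ᵗ T))) tc≡∞ ⟩
      suc m * suc n * (rent+singles + suc n * 0)   ≡⟨ regroup m n rent+singles ⟩
      suc n * (suc m * rent+singles)               ≤⟨ *-monoʳ-≤ (suc n) upper ⟩
      suc n * ((1 + 2 * m) * indicative ψ°)        ≤⟨ *-monoʳ-≤ (suc n) (*-monoʳ-≤ (1 + 2 * m) Ψ°≤opt) ⟩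
      -- The remaining claim is 2 Cs - 1 ≤ Cs Cc. The left side is split as Cs + m and compared with
      -- Cs + Cs n, using 1 ≤ n.
      suc n * ((1 + 2 * m) * opt)                  ≡⟨ split m n opt ⟩
      (suc m * 1 + m * 1 + (1 + 2 * m) * n) * opt
        ≤⟨ *-monoˡ-≤ opt (+-monoˡ-≤ _ (+-monoʳ-≤ (suc m * 1) (*-monoʳ-≤ m 1≤n))) ⟩
      (suc m * 1 + m * n + (1 + 2 * m) * n) * opt
        ≤⟨ *-monoˡ-≤ opt (+-monoˡ-≤ _ (+-monoʳ-≤ (suc m * 1) (m≤n+m (m * n) n))) ⟩
      (suc m * 1 + suc m * n + (1 + 2 * m) * n) * opt
        ≡⟨ cong (λ z → (z + (1 + 2 * m) * n) * opt) (*-distribˡ-+ (suc m) 1 n) ⟨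
      (suc m * suc n + (1 + 2 * m) * n) * opt      ∎
      where
      regroup : ∀ m n r → suc m * suc n * (r + suc n * 0) ≡ suc n * (suc m * r)
      regroup = solve-∀
      split : ∀ m n o → suc n * ((1 + 2 * m) * o) ≡ (suc m * 1 + m * 1 + (1 + 2 * m) * n) * o
      split = solve-∀
      Ψ°≤opt : indicative ψ° ≤ opt
      Ψ°≤opt = begin
        indicative ψ°               ≡⟨ m≥n⇒m⊓n≡n (<⇒≤ bounded) ⟨
        suc n ⊓ indicative ψ°       ≡⟨ cong (λ v → suc n ⊓ indicative v) ψ≡ψ° ⟨
        suc n ⊓ indicative (ψ sₑ)   ≤⟨ lower ⟩
        opt                         ∎
    bound (inj₂ Cc≤Ψ) = begin
      suc m * suc n * (rent+singles + suc n * 𝟙 (tc sₑ ≤ᵗ T))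
        ≤⟨ *-monoʳ-≤ (suc m * suc n) (+-monoʳ-≤ rent+singles (*-monoʳ-≤ (suc n) (𝟙≤1 (tc sₑ ≤ᵗ T)))) ⟩
      suc m * suc n * (rent+singles + suc n * 1)               ≡⟨ regroup m n rent+singles ⟩
      (suc m * rent+singles + suc m * suc n) * suc n
        -- Strictness of `bounded` gives the factor n = Cc - 1.
        ≤⟨ *-monoˡ-≤ (suc n) (+-monoˡ-≤ _ (≤-trans upper (*-monoʳ-≤ (1 + 2 * m) (≤-pred bounded)))) ⟩
      ((1 + 2 * m) * n + suc m * suc n) * suc n                ≡⟨ cong (_* suc n) (+-comm ((1 + 2 * m) * n) _) ⟩
      (suc m * suc n + (1 + 2 * m) * n) * suc n
        -- The final Ψ is at least Cc, so `lower` reads Cc ≤ `opt` and the trailing factor Cc is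
        -- absorbed.
        ≤⟨ *-monoʳ-≤ (suc m * suc n + (1 + 2 * m) * n) (≤-trans (≤-reflexive (sym (m≤n⇒m⊓n≡m Cc≤Ψ))) lower) ⟩
      (suc m * suc n + (1 + 2 * m) * n) * opt                  ∎
      where
      regroup : ∀ m n r → suc m * suc n * (r + suc n * 1) ≡ (suc m * r + suc m * suc n) * suc n
      regroup = solve-∀

-- Transfer to rational numbers

-- `toℚ` reduces by a gcd that is stuck on a variable; passing to unnormalised fractions removes it
-- from the arithmetic below.
toℚᵘ-toℚ : ∀ a → ℚ.toℚᵘ (toℚ a) ℚᵘ.≃ + a ℚᵘ./ 1
toℚᵘ-toℚ a = ℚ.toℚᵘ-fromℚᵘ (+ a ℚᵘ./ 1)

toℚ-homo-+ : ∀ a b → toℚ (a + b) ≡ toℚ a ℚ.+ toℚ b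
toℚ-homo-+ a b = ℚ.toℚᵘ-injective (begin-equality
  ℚ.toℚᵘ (toℚ (a + b))                 ≃⟨ toℚᵘ-toℚ (a + b) ⟩
  + (a + b) ℚᵘ./ 1                     ≡⟨ cong (ℚᵘ._/ 1) (cong₂ ℤ._+_ (ℤ.*-identityʳ (+ a)) (ℤ.*-identityʳ (+ b))) ⟨
  (+ a ℚᵘ./ 1) ℚᵘ.+ (+ b ℚᵘ./ 1)       ≃⟨ ℚᵘ.+-cong (toℚᵘ-toℚ a) (toℚᵘ-toℚ b) ⟨
  ℚ.toℚᵘ (toℚ a) ℚᵘ.+ ℚ.toℚᵘ (toℚ b)   ≃⟨ ℚ.toℚᵘ-homo-+ (toℚ a) (toℚ b) ⟨
  ℚ.toℚᵘ (toℚ a ℚ.+ toℚ b)             ∎)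
  where open ℚᵘ.≤-Reasoning

toℚ-homo-* : ∀ a b → toℚ (a * b) ≡ toℚ a ℚ.* toℚ b
toℚ-homo-* a b = ℚ.toℚᵘ-injective (begin-equality
  ℚ.toℚᵘ (toℚ (a * b))                 ≃⟨ toℚᵘ-toℚ (a * b) ⟩
  + (a * b) ℚᵘ./ 1                     ≡⟨ cong (ℚᵘ._/ 1) (ℤ.pos-* a b) ⟩
  (+ a ℚᵘ./ 1) ℚᵘ.* (+ b ℚᵘ./ 1)       ≃⟨ ℚᵘ.*-cong (toℚᵘ-toℚ a) (toℚᵘ-toℚ b) ⟨
  ℚ.toℚᵘ (toℚ a) ℚᵘ.* ℚ.toℚᵘ (toℚ b)   ≃⟨ ℚ.toℚᵘ-homo-* (toℚ a) (toℚ b) ⟨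
  ℚ.toℚᵘ (toℚ a ℚ.* toℚ b)             ∎)
  where open ℚᵘ.≤-Reasoning

toℚ-mono-≤ : ∀ {a b} → a ≤ b → toℚ a ℚ.≤ toℚ b
toℚ-mono-≤ {a} {b} a≤b = ℚ.toℚᵘ-cancel-≤ (begin
  ℚ.toℚᵘ (toℚ a)   ≃⟨ toℚᵘ-toℚ a ⟩
  + a ℚᵘ./ 1       ≤⟨ ℚᵘ.*≤* (ℤ.*-monoʳ-≤-nonNeg (+ 1) (ℤ.+≤+ a≤b)) ⟩
  + b ℚᵘ./ 1       ≃⟨ toℚᵘ-toℚ b ⟨
  ℚ.toℚᵘ (toℚ b)   ∎)
  where open ℚᵘ.≤-Reasoning

1/n*n≡1 : ∀ n .{{_ : NonZero n}} → (+ 1 / n) ℚ.* toℚ n ≡ ℚ.1ℚ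
1/n*n≡1 n@(suc k) = ℚ.toℚᵘ-injective (begin-equality
  ℚ.toℚᵘ ((+ 1 / n) ℚ.* toℚ n)             ≃⟨ ℚ.toℚᵘ-homo-* (+ 1 / n) (toℚ n) ⟩
  ℚ.toℚᵘ (+ 1 / n) ℚᵘ.* ℚ.toℚᵘ (toℚ n)     ≃⟨ ℚᵘ.*-cong (ℚ.toℚᵘ-fromℚᵘ (+ 1 ℚᵘ./ n)) (toℚᵘ-toℚ n) ⟩
  (+ 1 ℚᵘ./ n) ℚᵘ.* (+ n ℚᵘ./ 1)           ≃⟨ ℚᵘ.*≡* (ℤ.*-assoc (+ 1) (+ n) (+ 1)) ⟩
  ℚᵘ.1ℚᵘ                                   ∎)
  where open ℚᵘ.≤-Reasoning

-- The right-hand side is Cs Cc + (2 Cs − 1)(Cc − 1), written without subtraction.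
ratio≡ : ∀ m n → let Cs = suc m; Cc = suc n in
  ((+ 3 / 1) ℚ.- (+ 1 / Cs) ℚ.- (+ 1 / Cc) ℚ.* ((+ 2 / 1) ℚ.- (+ 1 / Cs))) ℚ.* toℚ (Cs * Cc)
    ≡ toℚ (Cs * Cc + (1 + 2 * m) * n)
ratio≡ m n = begin
  (three ℚ.- x ℚ.- y ℚ.* (two ℚ.- x)) ℚ.* toℚ (suc m * suc n)
    ≡⟨ cong (ℚ._*_ (three ℚ.- x ℚ.- y ℚ.* (two ℚ.- x))) (toℚ-homo-* (suc m) (suc n)) ⟩
  (three ℚ.- x ℚ.- y ℚ.* (two ℚ.- x)) ℚ.* (S ℚ.* C)
    -- The ring solver cannot know that x S = 1 and y C = 1, so these products are isolated first
    -- and replaced in the next step.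
    ≡⟨ solve 4 (λ x y S C →
         (con three :- x :- y :* (con two :- x)) :* (S :* C)
           := con three :* (S :* C) :- (x :* S) :* C :- (y :* C) :* (con two :* S :- x :* S)) refl x y S C ⟩
  three ℚ.* (S ℚ.* C) ℚ.- (x ℚ.* S) ℚ.* C ℚ.- (y ℚ.* C) ℚ.* (two ℚ.* S ℚ.- x ℚ.* S)
    ≡⟨ cong₂ (λ u v → three ℚ.* (S ℚ.* C) ℚ.- u ℚ.* C ℚ.- v ℚ.* (two ℚ.* S ℚ.- u)) (1/n*n≡1 (suc m)) (1/n*n≡1 (suc n)) ⟩
  three ℚ.* (S ℚ.* C) ℚ.- ℚ.1ℚ ℚ.* C ℚ.- ℚ.1ℚ ℚ.* (two ℚ.* S ℚ.- ℚ.1ℚ)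
    ≡⟨ cong₂ (λ S C → three ℚ.* (S ℚ.* C) ℚ.- ℚ.1ℚ ℚ.* C ℚ.- ℚ.1ℚ ℚ.* (two ℚ.* S ℚ.- ℚ.1ℚ)) (toℚ-homo-+ 1 m) (toℚ-homo-+ 1 n) ⟩
  three ℚ.* ((ℚ.1ℚ ℚ.+ M) ℚ.* (ℚ.1ℚ ℚ.+ N)) ℚ.- ℚ.1ℚ ℚ.* (ℚ.1ℚ ℚ.+ N) ℚ.- ℚ.1ℚ ℚ.* (two ℚ.* (ℚ.1ℚ ℚ.+ M) ℚ.- ℚ.1ℚ)
    ≡⟨ solve 2 (λ M N → let I = con ℚ.1ℚ in
         con three :* ((I :+ M) :* (I :+ N)) :- I :* (I :+ N) :- I :* (con two :* (I :+ M) :- I)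
           := (I :+ M) :* (I :+ N) :+ (I :+ con two :* M) :* N) refl M N ⟩
  (ℚ.1ℚ ℚ.+ M) ℚ.* (ℚ.1ℚ ℚ.+ N) ℚ.+ (ℚ.1ℚ ℚ.+ two ℚ.* M) ℚ.* N
    ≡⟨ cong₂ ℚ._+_ (trans (toℚ-homo-* (suc m) (suc n)) (cong₂ ℚ._*_ (toℚ-homo-+ 1 m) (toℚ-homo-+ 1 n)))
         (trans (toℚ-homo-* (1 + 2 * m) n)
           (cong (ℚ._* N) (trans (toℚ-homo-+ 1 (2 * m)) (cong (ℚ.1ℚ ℚ.+_) (toℚ-homo-* 2 m))))) ⟨
  toℚ (suc m * suc n) ℚ.+ toℚ ((1 + 2 * m) * n)  ≡⟨ toℚ-homo-+ (suc m * suc n) _ ⟨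
  toℚ (suc m * suc n + (1 + 2 * m) * n)  ∎
  where
  open ≡-Reasoning
  open +-*-Solver
  three = + 3 / 1
  two = + 2 / 1
  x = + 1 / suc m
  y = + 1 / suc n
  S = toℚ (suc m)
  C = toℚ (suc n)
  M = toℚ m
  N = toℚ n

theorem3p1 : ∀ (K Cs Cc : ℕ) .{{_ : NonZero Cs}} .{{_ : NonZero Cc}} →
    1 < Cs → Cs < Cc → Cc < K * Cs →
    CompetitiveRatioAtMost Cs Cc {K} (RDTSR Cs Cc)
    ((+ 3 / 1) ℚ.- (+ 1 / Cs) ℚ.- (+ 1 / Cc) ℚ.* ((+ 2 / 1) ℚ.- (+ 1 / Cs)))
theorem3p1 K Cs@(suc m) Cc@(suc n) 1<Cs Cs<Cc _ D =
  -- Both sides are multiplied by P = Cs Cc > 0, which turns the claim into the integer inequality.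
  ℚ.*-cancelʳ-≤-pos (toℚ P) {{ℚ.normalize-pos P 1}} (begin
    toℚ alg ℚ.* toℚ P           ≡⟨ ℚ.*-comm (toℚ alg) (toℚ P) ⟩
    toℚ P ℚ.* toℚ alg           ≡⟨ toℚ-homo-* P alg ⟨
    toℚ (P * alg)               ≤⟨ toℚ-mono-≤ (RDTSR-ratio m n 1≤n D σ (proj₁ σ-optimal)) ⟩
    toℚ (N * opt)               ≡⟨ toℚ-homo-* N opt ⟩
    toℚ N ℚ.* toℚ opt           ≡⟨ cong (ℚ._* toℚ opt) (ratio≡ m n) ⟨
    c ℚ.* toℚ P ℚ.* toℚ opt     ≡⟨ swap c (toℚ P) (toℚ opt) ⟩
    c ℚ.* toℚ opt ℚ.* toℚ P     ∎)
  where
  open ℚ.≤-Reasoning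
  open +-*-Solver
  P = Cs * Cc
  N = Cs * Cc + (1 + 2 * m) * n
  c = (+ 3 / 1) ℚ.- (+ 1 / Cs) ℚ.- (+ 1 / Cc) ℚ.* ((+ 2 / 1) ℚ.- (+ 1 / Cs))
  σ = proj₁ (optimal Cs Cc D)
  σ-optimal = proj₂ (optimal Cs Cc D)
  alg = cost Cs Cc D (RDTSR Cs Cc D)
  opt = OPT Cs Cc D
  1≤n : 1 ≤ n
  1≤n = ≤-trans (<⇒≤ 1<Cs) (≤-pred Cs<Cc)
  swap : ∀ x y z → x ℚ.* y ℚ.* z ≡ x ℚ.* z ℚ.* y
  swap = solve 3 (λ x y z → x :* y :* z := x :* z :* y) refl
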